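{- Let $\vec{k}=(k_1,\dots,k_n)$ be a vector of positive integers and let $\overline{D}\in\mathcal{D}_{\mathcal{K}}$ be any path, with sweep map image $D=\Phi(\overline{D})$. Then $$\operatorname{dinv}(\overline{D})=\operatorname{area}(D)\qquad\text{and}\qquad \operatorname{area}(\overline{D})=\operatorname{bounce}(D).$$
   Context: Paths. Let $\vec{k}=(k_1,\dots,k_n)$ be positive integers and $|\vec{k}|=\sum_i k_i$. A $\vec{k}$-Dyck path is a sequence $D=(a_1,\dots,a_{|\vec{k}|+n})$ obtained by interspersing $|\vec{k}|$ entries equal to $-1$ among $k_1,k_2,\dots,k_n$ (in this order), such that every partial sum $r_j=a_1+\cdots+a_{j-1}$ ($1\le j\le |\vec{k}|+n$) is $\ge 0$. Drawn as a lattice path from $(0,0)$ to $(|\vec{k}|+n,0)$ with steps $(1,a_j)$ that never goes below the horizontal axis, an entry $k_i$ is an up step called a red arrow, and an entry $-1$ is a down step called a blue arrow. Equivalently (model 1), $D$ is a path from $(0,0)$ to $(|\vec{k}|,|\vec{k}|)$ that never goes below $y=x$, with north steps of lengths $k_1,\dots,k_n$ from bottom to top (one per red arrow) and unit east steps (one per blue arrow), read in the same order. Let $\mathcal{D}_{\vec{k}}$ be the set of $\vec{k}$-Dyck paths and $\mathcal{D}_{\mathcal{K}}$ the union of $\mathcal{D}_{\vec{k}'}$ over all rearrangements $\vec{k}'$ of $\vec{k}$. Ranks and orders. For the $j$-th arrow $A$, $r(A)=r_j$ is its starting rank, $\dot r(A)=r_{j+1}$ (with $\dot r=0$ for the last arrow)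 is its end rank, and $\ell(A)=\dot r(A)-r(A)$. For arrows $A,B$: $A<B$ means $A$ occurs to the left of (before) $B$; $A<^sB$ (sweep order) means $r(A)<r(B)$, or $r(A)=r(B)$ and $B<A$. Sweep map. $\Phi(D)$ is the sequence of arrows (entries) of $D$ listed in increasing sweep order, i.e. by starting rank from bottom to top and from right to left at equal rank. $\Phi(D)$ is a $\vec{k}'$-Dyck path for some rearrangement $\vec{k}'$ of $\vec{k}$, and $\Phi$ is a bijection of $\mathcal{D}_{\mathcal{K}}$ to itself. Area. $\operatorname{area}(D)=\sum_{S} r(S)$, summed over all red arrows $S$ of $D$. Dinv. A blue arrow $W$ with $W<S$ sweeps a red arrow $S$ (written $W\to S$) if $W$ meets $S$ when $W$ is translated to the right along a line of slope $\epsilon$, $0<\epsilon\ll1$; equivalently $r(S)\le r(W)\le \dot r(S)$. Then $$\operatorname{dinv}(D)=\sum_{W<S}\chi(W\to S)+\sum_{S_i<S_j}\chi\big(r(S_i)\ge r(S_j)\ \&\ \dot r(S_j)>\dot r(S_i)\big)(\dot r(S_j)-\dot r(S_i))+\sum_{S_i<S_j}\chi\big(r(S_i)<r(S_j)\ \&\ \dot r(S_j)<\dot r(S_i)\big)(\dot r(S_i)-\dot r(S_j)),$$ where the first sum is over blue $W$ and red $S$, the others over pairs of red arrows, and $\chi$ is the indicator function. Bounce. Let $D\in\mathcal{D}_{\vec{k}'}$, $\vec{k}'=(k'_1,\dots,k'_n)$, in model 1. Build the bounce path and a tableau with $n$ columns, column $j$ having $k'_j+1$ cells, as follows. Start at $P_0=(0,0)$.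 For $i=0,1,2,\dots$: from $P_i$ move due north to the first point $Q_i$ of $D$ that is the west end of an east step of $D$ ($Q_i=P_i$ is allowed); let $v_i$ be the number of north steps of $D$ traversed. Write the value $i$ at the top of the next $v_i$ empty columns (leftmost first), and fill every column whose top entry is $a$ with $a,a+1,\dots,a+k'_j$ from top to bottom; call the result $R^{i+1}$. Let $h_i$ be the number of entries equal to $i+1$ in $R^{i+1}$, and move due east $h_i$ units to $P_{i+1}$. Stop upon reaching $(|\vec{k}'|,|\vec{k}'|)$. Then $\operatorname{bounce}(D)=\sum_{i\ge0} i\,v_i$, i.e. the sum of the top-row entries of the final tableau. -}

module Defs where

open import Data.Bool using (Bool; true; false; if_then_else_; _∧_; _∨_)
open import Data.Nat as ℕ using (ℕ; zero; suc; _∸_)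
open import Data.Integer as ℤ using (ℤ; +_)
open import Data.Nat.ListAction using (sum)
open import Data.List using (List; []; _∷_; _++_; map; length; replicate; take; zipWith; foldr)
open import Data.List.Relation.Unary.All using (All)
open import Data.List.Relation.Binary.Permutation.Propositional using (_↭_)
open import Data.Product using (_×_; _,_; proj₁; proj₂)
open import Relation.Nullary.Decidable using (⌊_⌋)
open import Relation.Binary.PropositionalEquality using (_≡_)

-- Arrows and paths.
-- A path is the sequence (a_1, ..., a_{|k|+n}) of its entries:
-- a red arrow (up step) carrying its value k_i, or a blue arrow (-1).

data Arrow : Set where
  red  : ℕ → Arrow
  blue : Arrow

Path : Set
Path = List Arrow

val : Arrow → ℤ
val (red k) = + k
val blue    = ℤ.- (+ 1)

reds : Path → List ℕ
reds []            = []
reds (red k ∷ as)  = k ∷ reds as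
reds (blue ∷ as)   = reds as

blues : Path → ℕ
blues []           = 0
blues (red _ ∷ as) = blues as
blues (blue ∷ as)  = suc (blues as)

ranksFrom : ℤ → Path → List ℤ
ranksFrom r []       = []
ranksFrom r (a ∷ as) = r ∷ ranksFrom (r ℤ.+ val a) as

ranks : Path → List ℤ
ranks = ranksFrom (+ 0)

IsDyck : Path → Set
IsDyck D = All (λ r → + 0 ℤ.≤ r) (ranks D)

InDK : List ℕ → Path → Set
InDK ks D = (reds D ↭ ks) × (blues D ≡ sum ks) × IsDyck D

-- Arrows annotated with starting rank r(A) and end rank ṙ(A)
-- (ṙ = 0 for the last arrow).

record AArrow : Set where
  constructor aarrow
  field
    arr : Arrow
    rk  : ℤ
    erk : ℤ
open AArrow public

annotFrom : ℤ → Path → List AArrow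
annotFrom r []               = []
annotFrom r (a ∷ [])         = aarrow a r (+ 0) ∷ []
annotFrom r (a ∷ as@(_ ∷ _)) = aarrow a r (r ℤ.+ val a) ∷ annotFrom (r ℤ.+ val a) as

annot : Path → List AArrow
annot = annotFrom (+ 0)

-- Sweep map: list the arrows in increasing sweep order
-- (A <ˢ B iff r(A) < r(B), or r(A) = r(B) and B occurs before A).
-- Arrows are tagged with their position so ties are broken right to left.

indexFrom : {A : Set} → ℕ → List A → List (ℕ × A)
indexFrom i []       = []
indexFrom i (x ∷ xs) = (i , x) ∷ indexFrom (suc i) xs

sweepLt : ℕ × (Arrow × ℤ) → ℕ × (Arrow × ℤ) → Bool
sweepLt (i , (_ , ri)) (j , (_ , rj)) =
  ⌊ ri ℤ.<? rj ⌋ ∨ (⌊ ri ℤ.≟ rj ⌋ ∧ ⌊ j ℕ.<? i ⌋)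

insertSweep : ℕ × (Arrow × ℤ) → List (ℕ × (Arrow × ℤ)) → List (ℕ × (Arrow × ℤ))
insertSweep x []       = x ∷ []
insertSweep x (y ∷ ys) = if sweepLt x y then x ∷ y ∷ ys else y ∷ insertSweep x ys

sortSweep : List (ℕ × (Arrow × ℤ)) → List (ℕ × (Arrow × ℤ))
sortSweep = foldr insertSweep []

zipRanks : Path → List ℤ → List (Arrow × ℤ)
zipRanks []       _        = []
zipRanks (_ ∷ _)  []       = []
zipRanks (a ∷ as) (r ∷ rs) = (a , r) ∷ zipRanks as rs

Φ : Path → Path
Φ D = map (λ p → proj₁ (proj₂ p)) (sortSweep (indexFrom 0 (zipRanks D (ranks D))))

areaA : List AArrow → ℤ
areaA []                       = + 0
areaA (aarrow (red _) r _ ∷ as) = r ℤ.+ areaA as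
areaA (aarrow blue _ _ ∷ as)    = areaA as

area : Path → ℤ
area D = areaA (annot D)

χ : Bool → ℤ
χ true  = + 1
χ false = + 0

dinvPair : AArrow → AArrow → ℤ
dinvPair (aarrow blue rW _) (aarrow (red _) rS eS) =
  χ (⌊ rS ℤ.≤? rW ⌋ ∧ ⌊ rW ℤ.≤? eS ⌋)
dinvPair (aarrow (red _) ri ei) (aarrow (red _) rj ej) =
  (if ⌊ rj ℤ.≤? ri ⌋ ∧ ⌊ ei ℤ.<? ej ⌋ then ej ℤ.- ei else + 0)
  ℤ.+ (if ⌊ ri ℤ.<? rj ⌋ ∧ ⌊ ej ℤ.<? ei ⌋ then ei ℤ.- ej else + 0)
dinvPair _ _ = + 0

sumℤ : List ℤ → ℤ
sumℤ = foldr ℤ._+_ (+ 0)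

pairSum : (AArrow → AArrow → ℤ) → List AArrow → ℤ
pairSum f []       = + 0
pairSum f (a ∷ as) = sumℤ (map (f a) as) ℤ.+ pairSum f as

dinv : Path → ℤ
dinv D = pairSum dinvPair (annot D)

-- number of red arrows (north steps) occurring before the (x+1)-th blue
-- arrow (east step); the height of the west end of the (x+1)-th east step
-- is the sum of the values of these reds.
redsBefore : ℕ → Path → ℕ
redsBefore x []                 = 0
redsBefore x (red _ ∷ as)       = suc (redsBefore x as)
redsBefore zero (blue ∷ as)     = 0
redsBefore (suc x) (blue ∷ as)  = redsBefore x as

-- number of filled columns j (top a_j, height k'_j + 1) whose entries
-- a_j, ..., a_j + k'_j contain the value m
countEntries : ℕ → List ℕ → List ℕ → ℕ
countEntries m tops ks =
  sum (zipWith (λ a k → if ⌊ a ℕ.≤? m ⌋ ∧ ⌊ m ℕ.≤? a ℕ.+ k ⌋ then 1 else 0) tops ks)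

-- One run of the bounce construction.
--   x    : x-coordinate of the current point P_i
--   c    : number of columns filled so far
--   i    : stage index
--   tops : top entries of the filled columns (leftmost first)
--   acc  : Σ_{i' < i} i' v_{i'}
-- fuel bounds the number of stages.
bounceLoop : Path → ℕ → ℕ → ℕ → ℕ → List ℕ → ℕ → ℕ
bounceLoop D zero x c i tops acc = acc
bounceLoop D (suc fuel) x c i tops acc =
  let ks    = reds D
      total = sum ks
      N     = if ⌊ x ℕ.<? total ⌋ then redsBefore x D else length ks
      v     = N ∸ c
      tops' = tops ++ replicate v i
      c'    = c ℕ.+ v
      h     = countEntries (suc i) tops' ks
      x'    = x ℕ.+ h
      y'    = sum (take c' ks)
      acc'  = acc ℕ.+ i ℕ.* v
  in if ⌊ x' ℕ.≟ total ⌋ ∧ ⌊ y' ℕ.≟ total ⌋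
     then acc'
     else bounceLoop D fuel x' c' (suc i) tops' acc'

bounce : Path → ℕ
bounce D = bounceLoop D (suc (sum (reds D) ℕ.+ length (reds D))) 0 0 0 [] 0

-- Dinv. The rank of a red arrow in Φ D is the sum of the values of the arrows
-- that precede it in sweep order, so area (Φ D) is a sum over pairs x < y of
-- arrows of D. It differs from the dinv sum, pair by pair, only by differences
-- of the functions t ↦ min (t, c) between the two end ranks of an arrow; these
-- telescope along D, and their totals cancel.
--
-- Bounce. In sweep order every positive rank starts with a blue arrow, since the
-- last arrow of D starting at that rank goes down. Hence the i-th bounce step
-- reaches exactly the red arrows of rank ≤ i, and the top entry of each column is
-- the rank of its red arrow in D. The entries i + 1 in the tableau count the upward
-- crossings of D from rank i to i + 1, which number as many as the downward ones,
-- the blue arrows of rank i + 1; this keeps the construction going.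
module Submission where

open import Defs
open import Data.Bool using (true; false; if_then_else_; _∧_)
open import Data.Integer as ℤ using (ℤ; +_; +≤+; +<+; ∣_∣)
import Data.Integer.Properties as ℤ
open import Data.Integer.Tactic.RingSolver using (solve-∀)
open import Data.List using (List; []; _∷_; _++_; map; foldr; filter; length; replicate; take)
open import Data.List.Properties using (map-∘; map-cong-local; ∷-injective; filter-all; filter-none; filter-complete; filter-accept; filter-reject; length-filter; length-++; length-replicate)
open import Data.List.Relation.Binary.Permutation.Propositional as ↭ using (_↭_; ↭-refl; ↭-sym; ↭-trans; prep; swap)
open import Data.List.Relation.Binary.Permutation.Propositional.Properties using (All-resp-↭; Any-resp-↭; map⁺)
open import Data.List.Relation.Unary.All as All using (All; []; _∷_)
open import Data.List.Relation.Unary.AllPairs using (AllPairs; []; _∷_)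
open import Data.List.Relation.Unary.Any using (Any; here; there)
open import Data.Nat as ℕ using (ℕ; zero; suc; _<_; _≤_; _∸_; z≤n; s≤s)
open import Data.Nat.ListAction using (sum)
open import Data.Nat.ListAction.Properties using (sum-++; sum-↭)
import Data.Nat.Properties as ℕ
open import Data.Product using (_×_; _,_; proj₁; proj₂)
open import Data.Sum using (_⊎_; inj₁; inj₂)
open import Relation.Binary.PropositionalEquality using (_≡_; refl; sym; trans; cong; cong₂; subst; module ≡-Reasoning)
open import Relation.Nullary using (Dec; ¬_; yes; no; contradiction)
open import Relation.Nullary.Decidable using (⌊_⌋)

-- Paths that return to rank 0.

data Closed : ℕ → Path → Set where
  []   : Closed 0 []
  up   : ∀ {r k as} → Closed (r ℕ.+ k) as → Closed r (red k ∷ as)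
  down : ∀ {r as} → Closed r as → Closed (suc r) (blue ∷ as)

-- Natural ranks in `Closed` absorb the nonnegativity condition. The balance equation follows the
-- current rank and forces it to be 0 at the end.
closed : ∀ r as → All (λ s → + 0 ℤ.≤ s) (ranksFrom (+ r) as) →
  r ℕ.+ sum (reds as) ≡ blues as → Closed r as
closed zero    []                   _         _  = []
closed r       (red k ∷ as)         (_ ∷ nn)  eq = up (closed (r ℕ.+ k) as nn (trans (ℕ.+-assoc r k _) eq))
closed (suc r) (blue ∷ as)          (_ ∷ nn)  eq = down (closed r as nn (ℕ.suc-injective eq))
-- A descent below 0 shows up only as the starting rank of the next arrow; for a last arrow the
-- balance equation excludes it.
closed zero    (blue ∷ a ∷ as)      (_ ∷ () ∷ _) eq

-- Annotation without a special clause for the last arrow: on a closed path its end rank is 0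
-- anyway.
steps : ℤ → Path → List AArrow
steps r []       = []
steps r (a ∷ as) = aarrow a r (r ℤ.+ val a) ∷ steps (r ℤ.+ val a) as

annotFrom-steps : ∀ {r as} → Closed r as → annotFrom (+ r) as ≡ steps (+ r) as
annotFrom-steps []                = refl
-- Abstracting `r + k` lets the match on `c` identify it with 0.
annotFrom-steps (up {r} {k} {[]} c) with r ℕ.+ k | c
... | _ | []                      = refl
annotFrom-steps (up {as = _ ∷ _} c) = cong (_ ∷_) (annotFrom-steps c)
annotFrom-steps (down {as = []} []) = refl
annotFrom-steps (down {as = _ ∷ _} c) = cong (_ ∷_) (annotFrom-steps c)

-- Finite sums and sums over ordered pairs.

+-interchange : ∀ a b c d → (a ℤ.+ b) ℤ.+ (c ℤ.+ d) ≡ (a ℤ.+ c) ℤ.+ (b ℤ.+ d)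
+-interchange = solve-∀

-‿chain : ∀ i j k → (i ℤ.- j) ℤ.+ (k ℤ.- i) ≡ k ℤ.- j
-‿chain = solve-∀

∑ : ∀ {A : Set} → (A → ℤ) → List A → ℤ
∑ f xs = sumℤ (map f xs)

∑-cong : ∀ {A : Set} {f g : A → ℤ} {xs} → All (λ x → f x ≡ g x) xs → ∑ f xs ≡ ∑ g xs
∑-cong eqs = cong sumℤ (map-cong-local eqs)

∑-ext : ∀ {A : Set} {f g : A → ℤ} → (∀ x → f x ≡ g x) → ∀ xs → ∑ f xs ≡ ∑ g xs
∑-ext f≡g xs = ∑-cong (All.tabulate {xs = xs} λ {x} _ → f≡g x)

∑-+ : ∀ {A : Set} (f g : A → ℤ) xs → ∑ (λ x → f x ℤ.+ g x) xs ≡ ∑ f xs ℤ.+ ∑ g xs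
∑-+ f g []       = refl
∑-+ f g (x ∷ xs) rewrite ∑-+ f g xs = +-interchange (f x) (g x) (∑ f xs) (∑ g xs)

∑-↭ : ∀ {A : Set} (f : A → ℤ) {xs ys} → xs ↭ ys → ∑ f xs ≡ ∑ f ys
∑-↭ f ↭.refl        = refl
∑-↭ f (prep x p)    = cong (λ z → f x ℤ.+ z) (∑-↭ f p)
∑-↭ f (↭.trans p q) = trans (∑-↭ f p) (∑-↭ f q)
∑-↭ f (swap {xs} {ys} x y p) rewrite ∑-↭ f p = eq (f x) (f y) (∑ f ys)
  where
  eq : ∀ a b c → a ℤ.+ (b ℤ.+ c) ≡ b ℤ.+ (a ℤ.+ c)
  eq = solve-∀

pairSum-cong : ∀ {P : AArrow → Set} {f g : AArrow → AArrow → ℤ} →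
  (∀ {x y} → P x → P y → f x y ≡ g x y) → ∀ {xs} → All P xs → pairSum f xs ≡ pairSum g xs
pairSum-cong f≡g []         = refl
pairSum-cong f≡g (px ∷ pxs) = cong₂ ℤ._+_ (∑-cong (All.map (f≡g px) pxs)) (pairSum-cong f≡g pxs)

pairSum-+ : ∀ (f g : AArrow → AArrow → ℤ) xs →
  pairSum (λ x y → f x y ℤ.+ g x y) xs ≡ pairSum f xs ℤ.+ pairSum g xs
pairSum-+ f g []       = refl
pairSum-+ f g (x ∷ xs) rewrite pairSum-+ f g xs | ∑-+ (f x) (g x) xs =
  +-interchange (∑ (f x) xs) (∑ (g x) xs) (pairSum f xs) (pairSum g xs)

-- The sweep map

-- In a list whose entries all occur to the right of x, the tie-break of the
-- sweep order puts x after every entry of equal rank.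
insert : AArrow → List AArrow → List AArrow
insert x []       = x ∷ []
insert x (y ∷ ys) = if ⌊ rk x ℤ.<? rk y ⌋ then x ∷ y ∷ ys else y ∷ insert x ys

sweep : List AArrow → List AArrow
sweep = foldr insert []

insert-↭ : ∀ x ys → insert x ys ↭ x ∷ ys
insert-↭ x []       = ↭-refl
insert-↭ x (y ∷ ys) with rk x ℤ.<? rk y
... | yes _ = ↭-refl
... | no  _ = ↭-trans (prep y (insert-↭ x ys)) (swap y x ↭-refl)

sweep-↭ : ∀ xs → sweep xs ↭ xs
sweep-↭ []       = ↭-refl
sweep-↭ (x ∷ xs) = ↭-trans (insert-↭ x (sweep xs)) (prep x (sweep-↭ xs))

unlabel : AArrow → Arrow × ℤ
unlabel x = arr x , rk x

zipRanks-steps : ∀ r as → zipRanks as (ranksFrom r as) ≡ map unlabel (steps r as)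
zipRanks-steps r []       = refl
zipRanks-steps r (a ∷ as) = cong (_ ∷_) (zipRanks-steps _ as)

insertSweep-All : ∀ {P : ℕ × (Arrow × ℤ) → Set} {x ys} → P x → All P ys → All P (insertSweep x ys)
insertSweep-All px []         = px ∷ []
insertSweep-All {x = x} {y ∷ _} px (py ∷ pys) with sweepLt x y
... | true  = px ∷ py ∷ pys
... | false = py ∷ insertSweep-All px pys

-- The bound `j` stays fixed while the running index grows, as the induction requires.
sortSweep-index : ∀ i {j} → j ≤ i → (xs : List (Arrow × ℤ)) → All (λ p → j ≤ proj₁ p) (sortSweep (indexFrom i xs))
sortSweep-index i j≤i []       = []
sortSweep-index i j≤i (x ∷ xs) = insertSweep-All j≤i (sortSweep-index (suc i) (ℕ.m≤n⇒m≤1+n j≤i) xs)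

insertSweep-insert : ∀ {i} x ps ys → All (λ p → i < proj₁ p) ps → map proj₂ ps ≡ map unlabel ys →
  map proj₂ (insertSweep (i , unlabel x) ps) ≡ map unlabel (insert x ys)
insertSweep-insert x [] [] _ _ = refl
insertSweep-insert {i} x ((j , _) ∷ ps) (y ∷ ys) (i<j ∷ i<ps) eq with ∷-injective eq
... | refl , tail-eq with rk x ℤ.<? rk y
... | yes _ = cong (unlabel x ∷_) eq
... | no  _ with rk x ℤ.≟ rk y | j ℕ.<? i
... | yes _ | yes j<i = contradiction j<i (ℕ.<-asym i<j)
... | yes _ | no  _   = cong (unlabel y ∷_) (insertSweep-insert x ps ys i<ps tail-eq)
... | no  _ | yes _   = cong (unlabel y ∷_) (insertSweep-insert x ps ys i<ps tail-eq)
... | no  _ | no  _   = cong (unlabel y ∷_) (insertSweep-insert x ps ys i<ps tail-eq)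

sortSweep-sweep : ∀ i xs → map proj₂ (sortSweep (indexFrom i (map unlabel xs))) ≡ map unlabel (sweep xs)
sortSweep-sweep i []       = refl
sortSweep-sweep i (x ∷ xs) = insertSweep-insert x (sortSweep (indexFrom (suc i) (map unlabel xs))) (sweep xs)
  (sortSweep-index (suc i) ℕ.≤-refl (map unlabel xs)) (sortSweep-sweep (suc i) xs)

Φ-sweep : ∀ D → Φ D ≡ map arr (sweep (steps (+ 0) D))
Φ-sweep D rewrite zipRanks-steps (+ 0) D =
  trans (map-∘ (sortSweep (indexFrom 0 (map unlabel (steps (+ 0) D)))))
  (trans (cong (map proj₁) (sortSweep-sweep 0 (steps (+ 0) D))) (sym (map-∘ (sweep (steps (+ 0) D)))))

-- Area

onRed : Arrow → ℤ → ℤ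
onRed (red _) z = z
onRed blue    z = + 0

onRed-+ : ∀ a y z → onRed a (y ℤ.+ z) ≡ onRed a y ℤ.+ onRed a z
onRed-+ (red _) y z = refl
onRed-+ blue    y z = refl

areaA-steps : ∀ {r as} → Closed r as → areaA (steps (+ r) as) ≡ ∑ (λ x → onRed (arr x) (rk x)) (steps (+ r) as)
areaA-steps []         = refl
areaA-steps (up {r} c) = cong (ℤ._+_ (+ r)) (areaA-steps c)
areaA-steps (down c)   = trans (areaA-steps c) (sym (ℤ.+-identityˡ _))

-- What `x` contributes to the starting rank of a later red arrow `y`.
lift : AArrow → AArrow → ℤ
lift x y = onRed (arr y) (val (arr x))

-- A starting rank is `r` plus the values of all preceding arrows; exchanging the two sums leaves
-- one `lift` for each ordered pair.
areaA-pairSum : ∀ r xs →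
  areaA (annotFrom r (map arr xs)) ≡ ∑ (λ y → onRed (arr y) r) xs ℤ.+ pairSum lift xs
areaA-pairSum r []                = refl
areaA-pairSum r (x ∷ [])          with arr x
... | red _ = sym (ℤ.+-identityʳ _)
... | blue  = refl
areaA-pairSum r (x ∷ xs@(_ ∷ _)) = begin
    areaA (annotFrom r (map arr (x ∷ xs)))
  ≡⟨ headArea (arr x) ⟩
    onRed (arr x) r ℤ.+ areaA (annotFrom (r ℤ.+ val (arr x)) (map arr xs))
  ≡⟨ cong (λ z → onRed (arr x) r ℤ.+ z) (areaA-pairSum _ xs) ⟩
    onRed (arr x) r ℤ.+ (∑ (λ y → onRed (arr y) (r ℤ.+ val (arr x))) xs ℤ.+ pairSum lift xs)
  ≡⟨ cong (λ z → onRed (arr x) r ℤ.+ (z ℤ.+ pairSum lift xs))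
       (trans (∑-ext (λ y → onRed-+ (arr y) r (val (arr x))) xs)
              (∑-+ (λ y → onRed (arr y) r) (lift x) xs)) ⟩
    onRed (arr x) r ℤ.+ ((∑ (λ y → onRed (arr y) r) xs ℤ.+ ∑ (lift x) xs) ℤ.+ pairSum lift xs)
  ≡⟨ eq (onRed (arr x) r) _ _ _ ⟩
    ∑ (λ y → onRed (arr y) r) (x ∷ xs) ℤ.+ pairSum lift (x ∷ xs)
  ∎
  where
  open ≡-Reasoning
  headArea : ∀ a → areaA (annotFrom r (a ∷ map arr xs)) ≡
    onRed a r ℤ.+ areaA (annotFrom (r ℤ.+ val a) (map arr xs))
  headArea (red _) = refl
  headArea blue    = sym (ℤ.+-identityˡ _)
  eq : ∀ a b c d → a ℤ.+ ((b ℤ.+ c) ℤ.+ d) ≡ (a ℤ.+ b) ℤ.+ (c ℤ.+ d)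
  eq = solve-∀

-- For `x` before `y` in the original path: the contribution of this pair to the area after the
-- sweep, where `y` comes first if the ranks are equal.
sweptLift : AArrow → AArrow → ℤ
sweptLift x y = if ⌊ rk x ℤ.<? rk y ⌋ then lift x y else lift y x

Ascending : List AArrow → Set
Ascending = AllPairs (λ x y → rk x ℤ.≤ rk y)

insert-ascending : ∀ x {ys} → Ascending ys → Ascending (insert x ys)
insert-ascending x []       = [] ∷ []
insert-ascending x {y ∷ ys} (y≤ys ∷ asc) with rk x ℤ.<? rk y
... | yes x<y = (ℤ.<⇒≤ x<y ∷ All.map (ℤ.≤-trans (ℤ.<⇒≤ x<y)) y≤ys) ∷ y≤ys ∷ asc
... | no  x≮y = All-resp-↭ (↭-sym (insert-↭ x ys)) (ℤ.≮⇒≥ x≮y ∷ y≤ys) ∷ insert-ascending x asc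

sweep-ascending : ∀ xs → Ascending (sweep xs)
sweep-ascending []       = []
sweep-ascending (x ∷ xs) = insert-ascending x (sweep-ascending xs)

insert-pairSum : ∀ x {ys} → Ascending ys → pairSum lift (insert x ys) ≡ ∑ (sweptLift x) ys ℤ.+ pairSum lift ys
insert-pairSum x []       = refl
insert-pairSum x {y ∷ ys} (y≤ys ∷ asc) with rk x ℤ.<? rk y
-- By ascent, `x` has smaller rank than everything after `y` too, so every test in `sweptLift x`
-- succeeds.
... | yes x<y = cong (ℤ._+ pairSum lift (y ∷ ys))
  (cong (λ z → lift x y ℤ.+ z)
    (∑-cong {f = lift x} {sweptLift x} (All.map (λ {z} y≤z → early {z} (ℤ.<-≤-trans x<y y≤z)) y≤ys)))
  where
  early : ∀ {z} → rk x ℤ.< rk z → lift x z ≡ sweptLift x z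
  early {z} x<z with rk x ℤ.<? rk z
  ... | yes _   = refl
  ... | no  x≮z = contradiction x<z x≮z
... | no  _ rewrite ∑-↭ (lift y) (insert-↭ x ys) | insert-pairSum x asc =
  +-interchange (lift y x) (∑ (lift y) ys) (∑ (sweptLift x) ys) (pairSum lift ys)

sweep-pairSum : ∀ xs → pairSum lift (sweep xs) ≡ pairSum sweptLift xs
sweep-pairSum []       = refl
sweep-pairSum (x ∷ xs) = trans (insert-pairSum x (sweep-ascending xs))
  (cong₂ ℤ._+_ (∑-↭ (sweptLift x) (sweep-↭ xs)) (sweep-pairSum xs))

area-Φ : ∀ D → area (Φ D) ≡ pairSum sweptLift (steps (+ 0) D)
area-Φ D rewrite Φ-sweep D = trans (areaA-pairSum (+ 0) (sweep (steps (+ 0) D)))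
  (trans (cong₂ ℤ._+_ (vanish (sweep (steps (+ 0) D))) (sweep-pairSum (steps (+ 0) D))) (ℤ.+-identityˡ _))
  where
  onRed-0 : ∀ a → onRed a (+ 0) ≡ + 0
  onRed-0 (red _) = refl
  onRed-0 blue    = refl
  vanish : ∀ xs → ∑ (λ y → onRed (arr y) (+ 0)) xs ≡ + 0
  vanish []       = refl
  vanish (x ∷ xs) = cong₂ ℤ._+_ (onRed-0 (arr x)) (vanish xs)

-- Dinv

Step : AArrow → Set
Step x = erk x ≡ rk x ℤ.+ val (arr x)

steps-Step : ∀ r as → All Step (steps r as)
steps-Step r []       = []
steps-Step r (a ∷ as) = refl ∷ steps-Step _ as

-- For x before y, the swept contribution of a pair is its dinv contribution plus
-- these two terms. Summed over the x before a red y the first telescopes to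
-- rk y, and summed over the y after a red x the second telescopes to - rk x.
preTerm postTerm : AArrow → AArrow → ℤ
preTerm  x y = onRed (arr y) ((erk x ℤ.⊓ erk y) ℤ.- (rk x ℤ.⊓ erk y))
postTerm x y = onRed (arr x) ((erk y ℤ.⊓ rk x) ℤ.- (rk y ℤ.⊓ rk x))

-- Prepending an arrow from `r` to `s` replaces the subtracted `s ⊓ erk y` by `r ⊓ erk y` for every
-- later red `y`; the new arrow itself contributes `(r ⊓ s) - (r ⊓ s)`.
sum-preTerm : ∀ r as →
  pairSum preTerm (steps r as) ≡ ∑ (λ y → onRed (arr y) ((rk y ℤ.⊓ erk y) ℤ.- (r ℤ.⊓ erk y))) (steps r as)
sum-preTerm r []       = refl
sum-preTerm r (a ∷ as) rewrite sum-preTerm (r ℤ.+ val a) as = trans (sym (∑-+ (preTerm x) f xs))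
  (trans (∑-ext (λ y → glue (arr y) (s ℤ.⊓ erk y) (r ℤ.⊓ erk y) (rk y ℤ.⊓ erk y)) xs)
    (sym (first a (r ℤ.⊓ s) _)))
  where
  s  = r ℤ.+ val a
  x  = aarrow a r s
  xs = steps s as
  f  = λ y → onRed (arr y) ((rk y ℤ.⊓ erk y) ℤ.- (s ℤ.⊓ erk y))
  eq : ∀ i j → (i ℤ.- i) ℤ.+ j ≡ j
  eq = solve-∀
  glue : ∀ b i j k → onRed b (i ℤ.- j) ℤ.+ onRed b (k ℤ.- i) ≡ onRed b (k ℤ.- j)
  glue (red _) i j k = -‿chain i j k
  glue blue    i j k = refl
  first : ∀ b i j → onRed b (i ℤ.- i) ℤ.+ j ≡ j
  first (red _) i j = eq i j
  first blue    i j = ℤ.+-identityˡ j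

∑-telescope : ∀ (g : ℤ → ℤ) {r as} → Closed r as →
  ∑ (λ y → g (erk y) ℤ.- g (rk y)) (steps (+ r) as) ≡ g (+ 0) ℤ.- g (+ r)
∑-telescope g []       = sym (ℤ.+-inverseʳ (g (+ 0)))
∑-telescope g (up {r} {k} c) rewrite ∑-telescope g c = -‿chain (g (+ (r ℕ.+ k))) (g (+ r)) (g (+ 0))
∑-telescope g (down {r} c) rewrite ∑-telescope g c = -‿chain (g (+ r)) (g (+ suc r)) (g (+ 0))

∑-0 : ∀ {A : Set} (xs : List A) → ∑ (λ _ → + 0) xs ≡ + 0
∑-0 []       = refl
∑-0 (_ ∷ xs) = trans (ℤ.+-identityˡ _) (∑-0 xs)

sum-postTerm : ∀ {r as} → Closed r as →
  pairSum postTerm (steps (+ r) as) ≡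
    ∑ (λ x → onRed (arr x) ((+ 0 ℤ.⊓ rk x) ℤ.- (erk x ℤ.⊓ rk x))) (steps (+ r) as)
sum-postTerm []               = refl
-- The arrows after this red one lead from its end rank to 0, so the values truncated at `r`
-- telescope.
sum-postTerm (up {r} c)       = cong₂ ℤ._+_ (∑-telescope (ℤ._⊓ (+ r)) c) (sum-postTerm c)
sum-postTerm (down {as = as} c) = cong₂ ℤ._+_ (∑-0 (steps _ as)) (sum-postTerm c)

steps-nonneg : ∀ {r as} → Closed r as → All (λ x → (+ 0 ℤ.≤ rk x) × (+ 0 ℤ.≤ erk x)) (steps (+ r) as)
steps-nonneg []       = []
steps-nonneg (up c)   = (+≤+ z≤n , +≤+ z≤n) ∷ steps-nonneg c
steps-nonneg (down c) = (+≤+ z≤n , +≤+ z≤n) ∷ steps-nonneg c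

-- Both totals run over the red arrows. Each of these contributes the minimum of its two ranks once
-- with either sign, and the minima with 0 vanish because ranks are nonnegative.
preTerm+postTerm : ∀ {D} → Closed 0 D →
  pairSum preTerm (steps (+ 0) D) ℤ.+ pairSum postTerm (steps (+ 0) D) ≡ + 0
preTerm+postTerm {D} c rewrite sum-preTerm (+ 0) D | sum-postTerm c =
  trans (sym (∑-+ _ _ (steps (+ 0) D)))
    (trans (∑-cong (All.map (λ {x} (0≤r , 0≤e) → cancel (arr x) 0≤r 0≤e) (steps-nonneg c))) (∑-0 (steps (+ 0) D)))
  where
  eq : ∀ i → (i ℤ.- + 0) ℤ.+ (+ 0 ℤ.- i) ≡ + 0
  eq = solve-∀
  cancel : ∀ a {r e} → + 0 ℤ.≤ r → + 0 ℤ.≤ e →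
    onRed a ((r ℤ.⊓ e) ℤ.- (+ 0 ℤ.⊓ e)) ℤ.+ onRed a ((+ 0 ℤ.⊓ r) ℤ.- (e ℤ.⊓ r)) ≡ + 0
  cancel blue    _ _ = refl
  cancel (red _) {r} {e} 0≤r 0≤e
    rewrite ℤ.i≤j⇒i⊓j≡i 0≤r | ℤ.i≤j⇒i⊓j≡i 0≤e | ℤ.⊓-comm e r = eq (r ℤ.⊓ e)

i<j⇒i≤j-1 : ∀ {i j} → i ℤ.< j → i ℤ.≤ j ℤ.+ ℤ.- + 1
i<j⇒i≤j-1 {i} {j} i<j = subst (i ℤ.≤_) (ℤ.+-comm (ℤ.- + 1) j) (ℤ.i<j⇒i≤pred[j] i<j)

-- Truncation at `j` turns a down step into minus an indicator, which matches the indicators for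
-- pairs of a blue and a red arrow.
⊓-pred : ∀ i j → ((i ℤ.+ ℤ.- + 1) ℤ.⊓ j) ℤ.- (i ℤ.⊓ j) ≡ ℤ.- χ ⌊ i ℤ.≤? j ⌋
⊓-pred i j with i ℤ.≤? j
... | yes i≤j rewrite ℤ.i≤j⇒i⊓j≡i i≤j | ℤ.i≤j⇒i⊓j≡i (ℤ.≤-trans (ℤ.i≤j⇒i-k≤j (+ 1) (ℤ.≤-refl {i})) i≤j) = eq i
  where
  eq : ∀ i → (i ℤ.+ ℤ.- + 1) ℤ.- i ≡ ℤ.- + 1
  eq = solve-∀
... | no  i≰j rewrite ℤ.i≥j⇒i⊓j≡j (ℤ.<⇒≤ (ℤ.≰⇒> i≰j))
                    | ℤ.i≥j⇒i⊓j≡j {i ℤ.+ ℤ.- + 1} {j} (i<j⇒i≤j-1 (ℤ.≰⇒> i≰j)) = ℤ.+-inverseʳ j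

-- For two red arrows, the swept contribution is the length of the one first in sweep order. Its
-- dinv part is the excess of that arrow's end rank over the smaller end rank; the rest remains of
-- the two extra terms once `rk x ⊓ erk y` cancels. If one arrow is blue, `⊓-pred` reduces
-- everything to indicators.
dinvPair-terms : ∀ {x y} → Step x → Step y →
  sweptLift x y ≡ dinvPair x y ℤ.+ (preTerm x y ℤ.+ postTerm x y)
dinvPair-terms {aarrow blue r _} {aarrow blue s _} refl refl with r ℤ.<? s
... | yes _ = refl
... | no  _ = refl
dinvPair-terms {aarrow blue r _} {aarrow (red k) s _} refl refl rewrite ⊓-pred r (s ℤ.+ + k) with r ℤ.<? s | s ℤ.≤? r
... | yes r<s | yes s≤r = contradiction r<s (ℤ.≤⇒≯ s≤r)
... | no  r≮s | no  s≰r = contradiction (ℤ.≮⇒≥ r≮s) s≰r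
... | no  _   | yes _   = eq (χ ⌊ r ℤ.≤? s ℤ.+ + k ⌋)
  where
  eq : ∀ i → + 0 ≡ i ℤ.+ (ℤ.- i ℤ.+ + 0)
  eq = solve-∀
... | yes r<s | no  _ with r ℤ.≤? s ℤ.+ + k
...   | yes _   = refl
...   | no  r≰e = contradiction (ℤ.≤-trans (ℤ.<⇒≤ r<s) (ℤ.i≤i+j s (+ k))) r≰e
dinvPair-terms {aarrow (red k) r _} {aarrow blue s _} refl refl rewrite ⊓-pred s r with r ℤ.<? s | s ℤ.≤? r
... | yes r<s | yes s≤r = contradiction r<s (ℤ.≤⇒≯ s≤r)
... | no  r≮s | no  s≰r = contradiction (ℤ.≮⇒≥ r≮s) s≰r
... | yes _   | no  _   = refl
... | no  _   | yes _   = refl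
dinvPair-terms {aarrow (red k) r _} {aarrow (red l) s _} refl refl
  rewrite ℤ.⊓-comm (s ℤ.+ + l) r with r ℤ.<? s | s ℤ.≤? r
... | yes r<s | yes s≤r = contradiction r<s (ℤ.≤⇒≯ s≤r)
... | no  r≮s | no  s≰r = contradiction (ℤ.≮⇒≥ r≮s) s≰r
... | yes r<s | no  _ rewrite ℤ.i≥j⇒i⊓j≡j (ℤ.<⇒≤ r<s) with s ℤ.+ + l ℤ.<? r ℤ.+ + k
...   | yes f<e rewrite ℤ.i≥j⇒i⊓j≡j (ℤ.<⇒≤ f<e) = eq (+ k) (s ℤ.+ + l) r _
  where
  eq : ∀ k f r m → k ≡ (+ 0 ℤ.+ ((r ℤ.+ k) ℤ.- f)) ℤ.+ ((f ℤ.- m) ℤ.+ (m ℤ.- r))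
  eq = solve-∀
...   | no  f≮e rewrite ℤ.i≤j⇒i⊓j≡i (ℤ.≮⇒≥ f≮e) = eq (+ k) r _
  where
  eq : ∀ k r m → k ≡ + 0 ℤ.+ (((r ℤ.+ k) ℤ.- m) ℤ.+ (m ℤ.- r))
  eq = solve-∀
dinvPair-terms {aarrow (red k) r _} {aarrow (red l) s _} refl refl
    | no  _   | yes s≤r rewrite ℤ.i≤j⇒i⊓j≡i s≤r with r ℤ.+ + k ℤ.<? s ℤ.+ + l
...   | yes e<f rewrite ℤ.i≤j⇒i⊓j≡i (ℤ.<⇒≤ e<f) = eq (+ l) (r ℤ.+ + k) s _
  where
  eq : ∀ l e s m → l ≡ (((s ℤ.+ l) ℤ.- e) ℤ.+ + 0) ℤ.+ ((e ℤ.- m) ℤ.+ (m ℤ.- s))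
  eq = solve-∀
...   | no  e≮f rewrite ℤ.i≥j⇒i⊓j≡j (ℤ.≮⇒≥ e≮f) = eq (+ l) s _
  where
  eq : ∀ l s m → l ≡ + 0 ℤ.+ (((s ℤ.+ l) ℤ.- m) ℤ.+ (m ℤ.- s))
  eq = solve-∀

dinv≡area-Φ : ∀ {D} → Closed 0 D → dinv D ≡ area (Φ D)
dinv≡area-Φ {D} c rewrite annotFrom-steps c = sym (begin
    area (Φ D)
  ≡⟨ area-Φ D ⟩
    pairSum sweptLift xs
  ≡⟨ pairSum-cong (λ {x} {y} → dinvPair-terms {x} {y}) (steps-Step (+ 0) D) ⟩
    pairSum (λ x y → dinvPair x y ℤ.+ (preTerm x y ℤ.+ postTerm x y)) xs
  ≡⟨ pairSum-+ dinvPair (λ x y → preTerm x y ℤ.+ postTerm x y) xs ⟩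
    pairSum dinvPair xs ℤ.+ pairSum (λ x y → preTerm x y ℤ.+ postTerm x y) xs
  ≡⟨ cong (λ z → pairSum dinvPair xs ℤ.+ z) (trans (pairSum-+ preTerm postTerm xs) (preTerm+postTerm c)) ⟩
    pairSum dinvPair xs ℤ.+ + 0
  ≡⟨ ℤ.+-identityʳ _ ⟩
    pairSum dinvPair xs
  ∎)
  where
  open ≡-Reasoning
  xs = steps (+ 0) D

-- Bounce

⌊⌋-yes : ∀ {P : Set} (P? : Dec P) → P → ⌊ P? ⌋ ≡ true
⌊⌋-yes (yes _) _ = refl
⌊⌋-yes (no ¬p) p = contradiction p ¬p

⌊⌋-no : ∀ {P : Set} (P? : Dec P) → ¬ P → ⌊ P? ⌋ ≡ false
⌊⌋-no (yes p) ¬p = contradiction p ¬p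
⌊⌋-no (no _)  _  = refl

-- The arrows are listed by increasing starting rank ≥ m, and the first arrow
-- of every rank larger than m is blue.
data Layered : ℕ → List AArrow → Set where
  []    : ∀ {m} → Layered m []
  level : ∀ {m a e xs} → Layered m xs → Layered m (aarrow a (+ m) e ∷ xs)
  rise  : ∀ {m n e xs} → m < n → Layered n xs → Layered m (aarrow blue (+ n) e ∷ xs)

layered-≥ : ∀ {m L} → Layered m L → All (λ x → + m ℤ.≤ rk x) L
layered-≥ []           = []
layered-≥ (level l)    = ℤ.≤-refl ∷ layered-≥ l
layered-≥ (rise m<n l) = +≤+ (ℕ.<⇒≤ m<n) ∷ All.map (ℤ.≤-trans (+≤+ (ℕ.<⇒≤ m<n))) (layered-≥ l)

-- `insert` puts an arrow after all entries of its rank, so it opens a level only if that rank is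
-- absent. The disjunction ensures that a red arrow never opens a level above `m`.
insert-layered : ∀ {m r a e ys} → Layered m ys → m ≤ r →
  a ≡ blue ⊎ m ≡ r ⊎ Any (λ y → rk y ≡ + r) ys → Layered m (insert (aarrow a (+ r) e) ys)
insert-layered {m} {r} [] m≤r c with m ℕ.≟ r | c
... | yes refl | _                    = level []
... | no m≢r   | inj₁ refl            = rise (ℕ.≤∧≢⇒< m≤r m≢r) []
... | no m≢r   | inj₂ (inj₁ m≡r)      = contradiction m≡r m≢r
... | no _     | inj₂ (inj₂ ())
insert-layered {m} {r} (level l) m≤r c with + r ℤ.<? + m | c
... | yes (+<+ r<m) | _                          = contradiction m≤r (ℕ.<⇒≱ r<m)
... | no _          | inj₁ eq                    = level (insert-layered l m≤r (inj₁ eq))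
... | no _          | inj₂ (inj₁ eq)             = level (insert-layered l m≤r (inj₂ (inj₁ eq)))
... | no _          | inj₂ (inj₂ (here refl))    = level (insert-layered l m≤r (inj₂ (inj₁ refl)))
... | no _          | inj₂ (inj₂ (there r∈xs))   = level (insert-layered l m≤r (inj₂ (inj₂ r∈xs)))
insert-layered {m} {r} (rise {n = n} m<n l) m≤r c with + r ℤ.<? + n | c
... | no r≮n        | inj₁ eq                    = rise m<n (insert-layered l (ℤ.drop‿+≤+ (ℤ.≮⇒≥ r≮n)) (inj₁ eq))
... | no r≮n        | inj₂ (inj₁ refl)           = contradiction (+<+ m<n) r≮n
... | no r≮n        | inj₂ (inj₂ (here refl))    = rise m<n (insert-layered l ℕ.≤-refl (inj₂ (inj₁ refl)))
... | no r≮n        | inj₂ (inj₂ (there r∈xs))   = rise m<n (insert-layered l (ℤ.drop‿+≤+ (ℤ.≮⇒≥ r≮n)) (inj₂ (inj₂ r∈xs)))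
... | yes (+<+ r<n) | inj₂ (inj₁ refl)           = level (rise m<n l)
... | yes (+<+ r<n) | inj₂ (inj₂ (here refl))    = contradiction r<n (ℕ.<-irrefl refl)
... | yes (+<+ r<n) | inj₂ (inj₂ (there r∈xs))   = contradiction r∈xs (absent (layered-≥ l))
  where
  absent : ∀ {xs} → All (λ x → + n ℤ.≤ rk x) xs → ¬ Any (λ x → rk x ≡ + r) xs
  absent (+≤+ n≤r ∷ _) (here refl) = ℕ.<⇒≱ r<n n≤r
  absent (_ ∷ n≤xs) (there r∈xs)   = absent n≤xs r∈xs
... | yes (+<+ r<n) | inj₁ refl with m ℕ.≟ r
...   | yes refl = level (rise m<n l)
...   | no  m≢r  = rise (ℕ.≤∧≢⇒< m≤r m≢r) (rise r<n l)

-- Down steps have height one, so a path that ends at 0 visits every positive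
-- rank not above its starting point.
steps-visit : ∀ {r s as} → Closed s as → 0 < r → r ≤ s → Any (λ x → rk x ≡ + r) (steps (+ s) as)
steps-visit [] 0<r r≤0 = contradiction r≤0 (ℕ.<⇒≱ 0<r)
steps-visit {r} {s} (up c) 0<r r≤s with r ℕ.≟ s
... | yes refl = here refl
... | no _     = there (steps-visit c 0<r (ℕ.m≤n⇒m≤n+o _ r≤s))
steps-visit {r} (down {s} c) 0<r r≤1+s with r ℕ.≟ suc s
... | yes refl = here refl
... | no r≢1+s = there (steps-visit c 0<r (ℕ.≤-pred (ℕ.≤∧≢⇒< r≤1+s r≢1+s)))

sweep-layered : ∀ {r as} → Closed r as → Layered 0 (sweep (steps (+ r) as))
sweep-layered []                 = []
sweep-layered (down c)           = insert-layered (sweep-layered c) z≤n (inj₁ refl)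
sweep-layered (up {zero} c)      = insert-layered (sweep-layered c) z≤n (inj₂ (inj₁ refl))
-- The rest of the path descends from `suc r + k` to 0, hence starts some arrow at rank `suc r`
-- again.
sweep-layered (up {suc r} {k} {as} c) = insert-layered (sweep-layered c) z≤n
  (inj₂ (inj₂ (Any-resp-↭ (↭-sym (sweep-↭ (steps _ as))) (steps-visit c (s≤s z≤n) (ℕ.m≤m+n (suc r) k)))))

-- Ranks of the red arrows in sweep order.

height : AArrow → ℕ
height x = ∣ rk x ∣

-- For the swept list this turns out to be the top row of the final tableau.
redHeights : List AArrow → List ℕ
redHeights []                        = []
redHeights (aarrow (red _) r _ ∷ xs) = ∣ r ∣ ∷ redHeights xs
redHeights (aarrow blue _ _ ∷ xs)    = redHeights xs

redHeights-All : ∀ {P : ℕ → Set} {L} → All (λ x → P (height x)) L → All P (redHeights L)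
redHeights-All []                                 = []
redHeights-All {L = aarrow (red _) _ _ ∷ _} (p ∷ ps) = p ∷ redHeights-All ps
redHeights-All {L = aarrow blue _ _ ∷ _}    (p ∷ ps) = redHeights-All ps

layered-height-≥ : ∀ {m L} → Layered m L → All (λ x → m ≤ height x) L
layered-height-≥ l = All.map (λ { (+≤+ m≤n) → m≤n }) (layered-≥ l)

redHeights-≥ : ∀ {m n L} → n ≤ m → Layered m L → All (n ≤_) (redHeights L)
redHeights-≥ n≤m l = redHeights-All (All.map (ℕ.≤-trans n≤m) (layered-height-≥ l))

redHeights-ascending : ∀ {m L} → Layered m L → AllPairs _≤_ (redHeights L)
redHeights-ascending []                   = []
redHeights-ascending (level {a = red _} l) = redHeights-≥ ℕ.≤-refl l ∷ redHeights-ascending l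
redHeights-ascending (level {a = blue} l)  = redHeights-ascending l
redHeights-ascending (rise _ l)           = redHeights-ascending l

length-redHeights : ∀ L → length (redHeights L) ≡ length (reds (map arr L))
length-redHeights []                        = refl
length-redHeights (aarrow (red _) _ _ ∷ xs) = cong suc (length-redHeights xs)
length-redHeights (aarrow blue _ _ ∷ xs)    = length-redHeights xs

∑-redHeights : ∀ {m L} → Layered m L → ∑ (λ x → onRed (arr x) (rk x)) L ≡ + sum (redHeights L)
∑-redHeights []                           = refl
∑-redHeights (level {m} {a = red _} l)    = cong (ℤ._+_ (+ m)) (∑-redHeights l)
∑-redHeights (level {a = blue} l)         = trans (ℤ.+-identityˡ _) (∑-redHeights l)
∑-redHeights (rise _ l)                   = trans (ℤ.+-identityˡ _) (∑-redHeights l)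

below : ℕ → List ℕ → List ℕ
below i = filter (ℕ._<? i)

below-∷ : ∀ {i x} xs → x < i → below i (x ∷ xs) ≡ x ∷ below i xs
below-∷ {i} xs x<i = filter-accept (ℕ._<? i) {xs = xs} x<i

below-none : ∀ {i xs} → All (i ≤_) xs → below i xs ≡ []
below-none {i} i≤xs = filter-none (ℕ._<? i) (All.map ℕ.≤⇒≯ i≤xs)

-- In an ascending list the entries below `i` form a prefix, and those that `suc i` adds are copies
-- of `i`: the columns filled at stage `i`.
below-suc : ∀ i {xs} → AllPairs _≤_ xs →
  below i xs ++ replicate (length (below (suc i) xs) ∸ length (below i xs)) i ≡ below (suc i) xs
below-suc i []                   = refl
below-suc i {x ∷ xs} (x≤xs ∷ asc) with x ℕ.<? i
... | yes x<i rewrite below-∷ xs x<i | below-∷ xs (ℕ.m<n⇒m<1+n x<i) = cong (x ∷_) (below-suc i asc)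
... | no  x≮i = trans (cong (λ ys → ys ++ replicate (length (below (suc i) (x ∷ xs)) ∸ length ys) i) (below-none i≤x∷xs))
                      (constant i≤x∷xs)
  where
  i≤x∷xs : All (i ≤_) (x ∷ xs)
  i≤x∷xs = ℕ.≮⇒≥ x≮i ∷ All.map (ℕ.≤-trans (ℕ.≮⇒≥ x≮i)) x≤xs
  constant : ∀ {ys} → All (i ≤_) ys → replicate (length (below (suc i) ys)) i ≡ below (suc i) ys
  constant []                   = refl
  constant {y ∷ ys} (i≤y ∷ i≤ys) with y ℕ.≟ i
  ... | yes refl rewrite below-∷ ys (ℕ.n<1+n i) = cong (i ∷_) (constant i≤ys)
  ... | no  y≢i rewrite filter-reject (ℕ._<? suc i) {y} {ys}
    (λ y<1+i → y≢i (ℕ.≤-antisym (ℕ.≤-pred y<1+i) i≤y)) = constant i≤ys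

-- Blue arrows of low rank and upward crossings.

lowBlue : ℕ → AArrow → ℕ
lowBlue i (aarrow (red _) _ _) = 0
lowBlue i (aarrow blue r _)    = if ⌊ ∣ r ∣ ℕ.≤? i ⌋ then 1 else 0

crossing : ℕ → AArrow → ℕ
crossing i (aarrow (red k) r _) = if ⌊ ∣ r ∣ ℕ.≤? i ⌋ ∧ ⌊ suc i ℕ.≤? ∣ r ∣ ℕ.+ k ⌋ then 1 else 0
crossing i (aarrow blue _ _)    = 0

lowBlues : ℕ → List AArrow → ℕ
lowBlues i L = sum (map (lowBlue i) L)

crossings : ℕ → List AArrow → ℕ
crossings i L = sum (map (crossing i) L)

sum-0 : ∀ {A : Set} (f : A → ℕ) {xs} → All (λ x → f x ≡ 0) xs → sum (map f xs) ≡ 0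
sum-0 f []       = refl
sum-0 f (p ∷ ps) = cong₂ ℕ._+_ p (sum-0 f ps)

lowBlue-high : ∀ {i} x → i < height x → lowBlue i x ≡ 0
lowBlue-high     (aarrow (red _) _ _) i<r = refl
lowBlue-high {i} (aarrow blue r _)    i<r rewrite ⌊⌋-no (∣ r ∣ ℕ.≤? i) (ℕ.<⇒≱ i<r) = refl

crossing-high : ∀ {i} x → i < height x → crossing i x ≡ 0
crossing-high {i} (aarrow (red _) r _) i<r rewrite ⌊⌋-no (∣ r ∣ ℕ.≤? i) (ℕ.<⇒≱ i<r) = refl
crossing-high     (aarrow blue _ _)    i<r = refl

-- The first blue arrow of rank > i precedes all other arrows of rank > i, so
-- the red arrows before it are exactly those of rank ≤ i.
redsBefore-lowBlues : ∀ i {m L} → Layered m L → m ≤ i →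
  redsBefore (lowBlues i L) (map arr L) ≡ length (below (suc i) (redHeights L))
redsBefore-lowBlues i [] m≤i = refl
redsBefore-lowBlues i (level {a = red _} {xs = xs} l) m≤i
  rewrite below-∷ (redHeights xs) (s≤s m≤i) = cong suc (redsBefore-lowBlues i l m≤i)
redsBefore-lowBlues i (level {m} {a = blue} l) m≤i
  rewrite ⌊⌋-yes (m ℕ.≤? i) m≤i = redsBefore-lowBlues i l m≤i
redsBefore-lowBlues i (rise {n = n} m<n l) m≤i with n ℕ.≤? i
... | yes n≤i = redsBefore-lowBlues i l n≤i
... | no  n≰i rewrite sum-0 (lowBlue i)
                      (All.map (λ {x} n≤x → lowBlue-high x (ℕ.<-≤-trans (ℕ.≰⇒> n≰i) n≤x)) (layered-height-≥ l))
                    | below-none (redHeights-≥ (ℕ.≰⇒> n≰i) l) = refl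

-- The tops at most `i` are a prefix of the red ranks, so `zipWith` pairs each with the value of its
-- own arrow. A column with such a top contains `suc i` exactly when its arrow climbs past the line
-- above `i`.
countEntries-crossings : ∀ i {m L} → Layered m L →
  countEntries (suc i) (below (suc i) (redHeights L)) (reds (map arr L)) ≡ crossings i L
countEntries-crossings i [] = refl
countEntries-crossings i (level {a = blue} l) = countEntries-crossings i l
countEntries-crossings i (rise _ l) = countEntries-crossings i l
countEntries-crossings i (level {m} {red k} {xs = xs} l) with m ℕ.≤? i
... | yes m≤i rewrite below-∷ (redHeights xs) (s≤s m≤i) | ⌊⌋-yes (m ℕ.≤? suc i) (ℕ.m≤n⇒m≤1+n m≤i) =
  cong (ℕ._+_ (if ⌊ suc i ℕ.≤? m ℕ.+ k ⌋ then 1 else 0)) (countEntries-crossings i l)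
... | no  m≰i rewrite below-none (ℕ.≰⇒> m≰i ∷ redHeights-≥ (ℕ.≰⇒> m≰i) l) =
  sym (sum-0 (crossing i)
    (All.map (λ {x} m≤x → crossing-high x (ℕ.<-≤-trans (ℕ.≰⇒> m≰i) m≤x)) (layered-height-≥ l)))

-- A closed path crosses the line between ranks i and i + 1 upwards as often as
-- downwards, and each downward crossing is a blue arrow of rank i + 1.
crossings-lowBlues : ∀ i {r as} → Closed r as →
  (crossings i (steps (+ r) as) ℕ.+ (if ⌊ suc i ℕ.≤? r ⌋ then 1 else 0)) ℕ.+ lowBlues i (steps (+ r) as)
    ≡ lowBlues (suc i) (steps (+ r) as)
crossings-lowBlues i [] rewrite ⌊⌋-no (suc i ℕ.≤? 0) (λ ()) = refl
crossings-lowBlues i (up {r} {k} {as} c) with r ℕ.≤? i | crossings-lowBlues i c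
... | yes r≤i | ih rewrite ⌊⌋-no (suc i ℕ.≤? r) (ℕ.≤⇒≯ r≤i) = trans
  (cong (ℕ._+ lowBlues i (steps (+ (r ℕ.+ k)) as)) (trans (ℕ.+-identityʳ _)
    (ℕ.+-comm (if ⌊ suc i ℕ.≤? r ℕ.+ k ⌋ then 1 else 0) _))) ih
... | no  r≰i | ih rewrite ⌊⌋-yes (suc i ℕ.≤? r) (ℕ.≰⇒> r≰i)
                         | ⌊⌋-yes (suc i ℕ.≤? r ℕ.+ k) (ℕ.≤-trans (ℕ.≰⇒> r≰i) (ℕ.m≤m+n r k)) = ih
crossings-lowBlues i (down {r} {as} c) with r ℕ.≤? i | crossings-lowBlues i c
... | no  r≰i | ih rewrite ⌊⌋-yes (suc i ℕ.≤? suc r) (ℕ.m≤n⇒m≤1+n (ℕ.≰⇒> r≰i))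
                         | ⌊⌋-yes (suc i ℕ.≤? r) (ℕ.≰⇒> r≰i)
                         | ⌊⌋-no (suc r ℕ.≤? i) (λ r<i → r≰i (ℕ.<⇒≤ r<i))
                         | ⌊⌋-no (suc r ℕ.≤? suc i) (λ { (s≤s r≤i) → r≰i r≤i }) = ih
... | yes r≤i | ih rewrite ⌊⌋-no (suc i ℕ.≤? r) (ℕ.≤⇒≯ r≤i) | ⌊⌋-yes (suc r ℕ.≤? suc i) (s≤s r≤i)
    with r ℕ.≟ i
-- This arrow is itself a downward crossing: it counts only in `lowBlues (suc i)`, and the summand
-- for starting above the line makes up for it.
...   | yes refl rewrite ⌊⌋-yes (suc r ℕ.≤? suc r) ℕ.≤-refl | ⌊⌋-no (suc r ℕ.≤? r) (ℕ.<-irrefl refl) =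
  trans (cong (ℕ._+ lowBlues r (steps (+ r) as)) (ℕ.+-suc _ 0)) (cong suc ih)
...   | no r≢i rewrite ⌊⌋-no (suc i ℕ.≤? suc r) (λ { (s≤s i≤r) → r≢i (ℕ.≤-antisym r≤i i≤r) })
                 | ⌊⌋-yes (suc r ℕ.≤? i) (ℕ.≤∧≢⇒< r≤i r≢i) =
  trans (ℕ.+-suc _ _) (cong suc ih)

lowBlues-0 : ∀ {r as} → Closed r as → lowBlues 0 (steps (+ r) as) ≡ 0
lowBlues-0 []       = refl
lowBlues-0 (up c)   = lowBlues-0 c
lowBlues-0 (down c) = lowBlues-0 c

-- Used to show that the fuel of `bounce` outlasts every rank.
steps-bound : ∀ {r as} → Closed r as → All (λ x → height x ≤ r ℕ.+ sum (reds as)) (steps (+ r) as)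
steps-bound []                 = []
steps-bound (up {r} {k} {as} c) = ℕ.m≤m+n r _ ∷
  All.map (λ {x} → subst (height x ≤_) (ℕ.+-assoc r k (sum (reds as)))) (steps-bound c)
steps-bound (down {r} c)       = ℕ.m≤m+n (suc r) _ ∷ All.map ℕ.m≤n⇒m≤1+n (steps-bound c)

-- Invariance under rearrangement, and auxiliary counts.

reds-↭ : ∀ {as bs} → as ↭ bs → reds as ↭ reds bs
reds-↭ ↭.refl                        = ↭-refl
reds-↭ (prep (red k) p)              = prep k (reds-↭ p)
reds-↭ (prep blue p)                 = reds-↭ p
reds-↭ (swap (red k) (red l) p)      = swap k l (reds-↭ p)
reds-↭ (swap (red k) blue p)         = prep k (reds-↭ p)
reds-↭ (swap blue (red k) p)         = prep k (reds-↭ p)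
reds-↭ (swap blue blue p)            = reds-↭ p
reds-↭ (↭.trans p q)                 = ↭-trans (reds-↭ p) (reds-↭ q)

blues-↭ : ∀ {as bs} → as ↭ bs → blues as ≡ blues bs
blues-↭ ↭.refl                       = refl
blues-↭ (prep (red _) p)             = blues-↭ p
blues-↭ (prep blue p)                = cong suc (blues-↭ p)
blues-↭ (swap (red _) (red _) p)     = blues-↭ p
blues-↭ (swap (red _) blue p)        = cong suc (blues-↭ p)
blues-↭ (swap blue (red _) p)        = cong suc (blues-↭ p)
blues-↭ (swap blue blue p)           = cong (λ n → suc (suc n)) (blues-↭ p)
blues-↭ (↭.trans p q)                = trans (blues-↭ p) (blues-↭ q)

arr-steps : ∀ r as → map arr (steps r as) ≡ as
arr-steps r []       = refl
arr-steps r (a ∷ as) = cong (a ∷_) (arr-steps _ as)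

redsBefore-all : ∀ {x} as → blues as ≤ x → redsBefore x as ≡ length (reds as)
redsBefore-all []              _         = refl
redsBefore-all (red _ ∷ as)    b≤x       = cong suc (redsBefore-all as b≤x)
redsBefore-all (blue ∷ as)     (s≤s b≤x) = redsBefore-all as b≤x

-- A proper prefix of positive values has a smaller sum, so reaching the full height means that
-- every column is filled.
take-all : ∀ c {ks} → All (0 <_) ks → sum (take c ks) ≡ sum ks → length ks ≤ c
take-all c       []                   _  = z≤n
take-all zero    {k ∷ _} (0<k ∷ _)    eq = contradiction (ℕ.m+n≡0⇒m≡0 k (sym eq)) (ℕ.>⇒≢ 0<k)
take-all (suc c) {k ∷ _} (_ ∷ pos)    eq = s≤s (take-all c pos (ℕ.+-cancelˡ-≡ k _ _ eq))

sum-replicate : ∀ n i → sum (replicate n i) ≡ i ℕ.* n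
sum-replicate zero    i = sym (ℕ.*-zeroʳ i)
sum-replicate (suc n) i = trans (cong (i ℕ.+_) (sum-replicate n i)) (sym (ℕ.*-suc i n))

-- The run of the bounce construction on a swept list.

module _ {L : List AArrow} (layered : Layered 0 L)
  (positive : All (0 <_) (reds (map arr L)))
  (balanced : sum (reds (map arr L)) ≡ blues (map arr L))
  (crossed : ∀ i → crossings i L ℕ.+ lowBlues i L ≡ lowBlues (suc i) L)
  where

  private
    D = map arr L
    ks = reds D
    total = sum ks
    heights = redHeights L

  redsReached : ∀ i →
    (if ⌊ lowBlues i L ℕ.<? total ⌋ then redsBefore (lowBlues i L) D else length ks) ≡
    length (below (suc i) heights)
  redsReached i with lowBlues i L ℕ.<? total
  ... | yes _   = redsBefore-lowBlues i layered z≤n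
  ... | no  x≮t = trans (sym (redsBefore-all D (subst (_≤ lowBlues i L) balanced (ℕ.≮⇒≥ x≮t))))
                        (redsBefore-lowBlues i layered z≤n)

  below-complete : ∀ i → sum (take (length (below i heights)) ks) ≡ total → below i heights ≡ heights
  below-complete i eq = filter-complete (ℕ._<? i) {heights} (ℕ.≤-antisym (length-filter (ℕ._<? i) heights)
    (subst (_≤ length (below i heights)) (sym (length-redHeights L)) (take-all _ positive eq)))

  -- After i stages the columns filled are those of the red arrows of rank < i,
  -- with their ranks as top entries, and x counts the blue arrows of rank ≤ i.
  bounceLoop-heights : ∀ fuel i → All (_< i ℕ.+ fuel) heights →
    bounceLoop D fuel (lowBlues i L) (length (below i heights)) i (below i heights) (sum (below i heights)) ≡ sum heights
  bounceLoop-heights zero i h<i =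
    cong sum (filter-all (ℕ._<? i) (subst (λ n → All (_< n) heights) (ℕ.+-identityʳ i) h<i))
  bounceLoop-heights (suc fuel) i h<i = trans (cong stage (redsReached i))
    (trans (cong₂ (λ tops (p : ℕ × ℕ) → next tops (proj₁ p) (proj₂ p)) tops-eq (cong₂ _,_ c-eq acc-eq))
      (trans (cong (λ x → finish x (length tops′) tops′ (sum tops′)) x-eq) final))
    where
    tops  = below i heights
    tops′ = below (suc i) heights
    v     = length tops′ ∸ length tops
    -- `finish`, `next` and `stage` restate the body of `bounceLoop` with successive quantities left
    -- variable, so that each can be replaced by `cong`.
    finish : ℕ → ℕ → List ℕ → ℕ → ℕ
    finish x c ts acc =
      if ⌊ x ℕ.≟ total ⌋ ∧ ⌊ sum (take c ks) ℕ.≟ total ⌋ then acc else bounceLoop D fuel x c (suc i) ts acc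
    next : List ℕ → ℕ → ℕ → ℕ
    next ts c acc = finish (lowBlues i L ℕ.+ countEntries (suc i) ts ks) c ts acc
    stage : ℕ → ℕ
    stage N = next (tops ++ replicate (N ∸ length tops) i) (length tops ℕ.+ (N ∸ length tops))
                   (sum tops ℕ.+ i ℕ.* (N ∸ length tops))
    tops-eq : tops ++ replicate v i ≡ tops′
    tops-eq = below-suc i (redHeights-ascending layered)
    c-eq : length tops ℕ.+ v ≡ length tops′
    c-eq = trans (sym (trans (length-++ tops) (cong (length tops ℕ.+_) (length-replicate v)))) (cong length tops-eq)
    acc-eq : sum tops ℕ.+ i ℕ.* v ≡ sum tops′
    acc-eq = trans (sym (trans (sum-++ tops (replicate v i)) (cong (sum tops ℕ.+_) (sum-replicate v i))))
                   (cong sum tops-eq)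
    x-eq : lowBlues i L ℕ.+ countEntries (suc i) tops′ ks ≡ lowBlues (suc i) L
    x-eq = trans (cong (lowBlues i L ℕ.+_) (countEntries-crossings i layered))
                 (trans (ℕ.+-comm (lowBlues i L) _) (crossed i))
    rest : bounceLoop D fuel (lowBlues (suc i) L) (length tops′) (suc i) tops′ (sum tops′) ≡ sum heights
    rest = bounceLoop-heights fuel (suc i) (subst (λ n → All (_< n) heights) (ℕ.+-suc i fuel) h<i)
    final : finish (lowBlues (suc i) L) (length tops′) tops′ (sum tops′) ≡ sum heights
    final with lowBlues (suc i) L ℕ.≟ total | sum (take (length tops′) ks) ℕ.≟ total
    ... | yes _ | yes eq = cong sum (below-complete (suc i) eq)
    ... | yes _ | no _   = rest
    ... | no _  | _      = rest

  bounce-heights : lowBlues 0 L ≡ 0 → All (_≤ total) heights → bounce D ≡ sum heights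
  bounce-heights x≡0 h≤t
    -- Every rank is at most `total`, hence below the fuel. The invariant at stage 0 is the initial
    -- state: no columns, and no blue arrows of rank 0.
    with bounceLoop-heights (suc (total ℕ.+ length ks)) 0
           (All.map (λ h≤ → s≤s (ℕ.m≤n⇒m≤n+o _ h≤)) h≤t)
  ... | eq rewrite x≡0 | below-none {0} {heights} (All.tabulate λ _ → z≤n) = eq

-- Area ignores the order of the arrows, so it can be read off the swept list, where it is the sum
-- of the top row.
area≡bounce-Φ : ∀ {D} → Closed 0 D → All (0 <_) (reds D) → sum (reds D) ≡ blues D → area D ≡ + bounce (Φ D)
area≡bounce-Φ {D} c pos bal rewrite annotFrom-steps c | Φ-sweep D = begin
    areaA (steps (+ 0) D)
  ≡⟨ areaA-steps c ⟩
    ∑ (λ x → onRed (arr x) (rk x)) (steps (+ 0) D)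
  ≡⟨ ∑-↭ (λ x → onRed (arr x) (rk x)) (↭-sym σ) ⟩
    ∑ (λ x → onRed (arr x) (rk x)) L
  ≡⟨ ∑-redHeights layered ⟩
    + sum (redHeights L)
  ≡⟨ cong +_ (sym (bounce-heights layered (All-resp-↭ (reds-↭ (↭-sym τ)) pos)
       (trans (sum-↭ (reds-↭ τ)) (trans bal (sym (blues-↭ τ)))) crossed
       (trans (sum-↭ (map⁺ (lowBlue 0) σ)) (lowBlues-0 c))
       (redHeights-All (All-resp-↭ (↭-sym σ)
         (All.map (λ {x} → subst (height x ≤_) (sym (sum-↭ (reds-↭ τ)))) (steps-bound c)))))) ⟩
    + bounce (map arr L)
  ∎
  where
  open ≡-Reasoning
  L = sweep (steps (+ 0) D)
  σ : L ↭ steps (+ 0) D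
  σ = sweep-↭ (steps (+ 0) D)
  τ : map arr L ↭ D
  τ = subst (map arr L ↭_) (arr-steps (+ 0) D) (map⁺ arr σ)
  layered : Layered 0 L
  layered = sweep-layered c
  crossed : ∀ i → crossings i L ℕ.+ lowBlues i L ≡ lowBlues (suc i) L
  crossed i rewrite sum-↭ (map⁺ (crossing i) σ) | sum-↭ (map⁺ (lowBlue i) σ) | sum-↭ (map⁺ (lowBlue (suc i)) σ) =
    trans (cong (ℕ._+ lowBlues i (steps (+ 0) D)) (sym (ℕ.+-identityʳ _))) (crossings-lowBlues i c)

theorem2p1 : (ks : List ℕ) → All (0 <_) ks → (D̄ : Path) → InDK ks D̄ →
    (dinv D̄ ≡ area (Φ D̄)) × (area D̄ ≡ + bounce (Φ D̄))
theorem2p1 ks pos D̄ (reds↭ks , blues≡ , dyck) =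
  dinv≡area-Φ c , area≡bounce-Φ c (All-resp-↭ (↭-sym reds↭ks) pos) bal
  where
  bal : sum (reds D̄) ≡ blues D̄
  bal = trans (sum-↭ reds↭ks) (sym blues≡)
  c : Closed 0 D̄
  c = closed 0 D̄ dyck bal
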